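{- Let $\mathcal X,\mathcal Y_1,\mathcal Y_2$ be finite nonempty sets. For any prior $\pi$ on $\mathcal X$ and any channels $(\mathcal X,\mathcal Y_1,C_1)$ and $(\mathcal X,\mathcal Y_2,C_2)$: (1) $H_\infty(\pi,C_1\parallel C_2)\ \ge\ H_\infty(\pi,C_1)+H_\infty(\pi,C_2)-H^{\min}(\pi)$; (2) $H_\infty(\pi,C_1\parallel C_2)\ \le\ \min\{H_\infty(\pi,C_1),H_\infty(\pi,C_2)\}$; (3) $I_\infty(\pi,C_1\parallel C_2)\ \ge\ \max\{I_\infty(\pi,C_1),I_\infty(\pi,C_2)\}$; (4) $I_\infty(\pi,C_1\parallel C_2)\ \le\ I_\infty(\pi,C_1)+I_\infty(\pi,C_2)+H^{\min}(\pi)-H_\infty(\pi)$.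
   Context: A (discrete) channel $(\mathcal X,\mathcal Y,C)$ consists of finite sets $\mathcal X,\mathcal Y$ and a matrix $C$ with entries $C[x,y]\ge 0$ and $\sum_{y}C[x,y]=1$ for each $x$. A prior on $\mathcal X$ is a probability distribution on $\mathcal X$. The parallel composition with shared input $C_1\parallel C_2$ is the channel from $\mathcal X$ to $\mathcal Y_1\times\mathcal Y_2$ with $(C_1\parallel C_2)[x,(y_1,y_2)]=C_1[x,y_1]\,C_2[x,y_2]$. $V(\pi)=\max_{x}\pi[x]$, $V(\pi,C)=\sum_y\max_x\pi[x]C[x,y]$, $H_\infty(\pi)=-\log V(\pi)$, $H_\infty(\pi,C)=-\log V(\pi,C)$, and the min-entropy leakage is $I_\infty(\pi,C)=H_\infty(\pi)-H_\infty(\pi,C)$. Also $H^{\min}(\pi)=-\log\min\{\pi[x]: x\in\mathcal X,\ \pi[x]\ne0\}$. Logarithms are to base 2. -}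

module Defs where

open import Level using (Level) renaming (suc to lsuc)
open import Algebra.Bundles using (CommutativeRing)
open import Algebra.Core using (Op₁; Op₂)
open import Algebra.Structures using (IsCommutativeRing)
open import Data.Fin.Base using (Fin; zero; suc; _↑ˡ_; _↑ʳ_; combine)
open import Data.Fin.Properties using (*↔×; remQuot-combine)
open import Data.List.Base using (filter; tabulate)
open import Data.Nat.Base using (ℕ; zero; suc)
import Data.Nat.Base as ℕ
open import Data.Product.Base using (∃; ∃-syntax; _×_; _,_)
open import Data.Product.Function.NonDependent.Propositional using (_×-↔_)
open import Function.Base using (_∘_)
open import Function.Bundles using (_↔_; module Inverse)
open import Function.Construct.Composition using (_↔-∘_)
open import Relation.Binary.Bundles using (DecTotalOrder)
open import Relation.Binary.Core using (Rel)
import Relation.Binary.PropositionalEquality as ≡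
open import Relation.Binary.Structures using (IsDecTotalOrder)
open import Relation.Nullary.Decidable using (¬?)
open import Relation.Nullary.Negation using (¬_)
open import Relation.Unary using (Pred)

-- The real numbers, given by their categorical axiomatisation: a Dedekind
-- complete ordered field, unique up to unique isomorphism.  The axioms are the
-- classical ones (the order is decidable, every inhabited bounded predicate
-- has a supremum); with excluded middle, the Dedekind cuts ℚ → Bool are a
-- model.  Nothing is asked of `sup` on predicates that are empty or unbounded.
record CompleteOrderedField (ℓ : Level) : Set (lsuc ℓ) where
  infix  4 _≈_ _≤_
  infixl 6 _+_
  infixl 7 _*_
  infix  8 -_
  field
    Carrier : Set ℓ
    _≈_ _≤_ : Rel Carrier ℓ
    _+_ _*_ : Op₂ Carrier
    -_      : Op₁ Carrier
    0# 1#   : Carrier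
    isCommutativeRing : IsCommutativeRing _≈_ _+_ _*_ -_ 0# 1#
    1≉0      : ¬ (1# ≈ 0#)
    inverse  : ∀ x → ¬ (x ≈ 0#) → ∃[ y ] (x * y ≈ 1#)
    isDecTotalOrder : IsDecTotalOrder _≈_ _≤_
    +-monoˡ-≤ : ∀ {x y} z → x ≤ y → x + z ≤ y + z
    *-nonNeg  : ∀ {x y} → 0# ≤ x → 0# ≤ y → 0# ≤ x * y

  UpperBound : Pred Carrier ℓ → Pred Carrier ℓ
  UpperBound P u = ∀ x → P x → x ≤ u

  field
    sup       : Pred Carrier ℓ → Carrier
    sup-upper : ∀ P → ∃ P → ∃ (UpperBound P) → UpperBound P (sup P)
    sup-least : ∀ P → ∃ P → ∃ (UpperBound P) → ∀ u → UpperBound P u → sup P ≤ u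

  commutativeRing : CommutativeRing ℓ ℓ
  commutativeRing = record { isCommutativeRing = isCommutativeRing }

  decTotalOrder : DecTotalOrder ℓ ℓ ℓ
  decTotalOrder = record { isDecTotalOrder = isDecTotalOrder }

  open DecTotalOrder decTotalOrder public using (_≥_; _≟_; totalOrder)
  open CommutativeRing commutativeRing public
    using (_-_; semiring; +-rawMonoid)

-- The inhabited finite sets: |X| = suc size-1.
record FiniteSet : Set₁ where
  field
    Elem        : Set
    size-1      : ℕ
    enumeration : Fin (suc size-1) ↔ Elem

  enum : Fin (suc size-1) → Elem
  enum = Inverse.to enumeration

infixr 2 _×ᶠ_

_×ᶠ_ : FiniteSet → FiniteSet → FiniteSet
X ×ᶠ Y = record
  { Elem        = X.Elem × Y.Elem
  ; size-1      = Y.size-1 ℕ.+ X.size-1 ℕ.* suc Y.size-1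
  ; enumeration =
      (X.enumeration ×-↔ Y.enumeration) ↔-∘ *↔× {suc X.size-1} {suc Y.size-1}
  }
  where
    module X = FiniteSet X
    module Y = FiniteSet Y

module Leakage {ℓ : Level} (ℝ : CompleteOrderedField ℓ) where

  open CompleteOrderedField ℝ
  open FiniteSet
  open import Algebra.Definitions.RawMonoid +-rawMonoid using (sum) renaming (_×_ to _·_)
  open import Algebra.Properties.Semiring.Exp semiring using (_^_)
  open import Algebra.Construct.NaturalChoice.Max totalOrder public using (_⊔_)
  open import Algebra.Construct.NaturalChoice.Min totalOrder public using (_⊓_)
  import Data.List.Extrema totalOrder as Extrema

  ∑ : (X : FiniteSet) → (Elem X → Carrier) → Carrier
  ∑ X f = sum (f ∘ enum X)

  -- `Extrema.max v xs` is the maximum of v together with xs.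
  maximum : (X : FiniteSet) → (Elem X → Carrier) → Carrier
  maximum X f = Extrema.max (f (enum X zero)) (tabulate (f ∘ enum X))

  -- ExponentBelow a w: w is a rational number and 2^w ≤ a.  Writing
  -- w = (p - r) / suc n, this says 2^p ≤ 2^r * a^(suc n).
  ExponentBelow : Carrier → Pred Carrier ℓ
  ExponentBelow a w = ∃[ p ] ∃[ r ] ∃[ n ]
    ((suc n · w + r · 1# ≈ p · 1#) × (2# ^ p ≤ 2# ^ r * a ^ suc n))
    where 2# = 1# + 1#

  -- The base-2 logarithm of a > 0; its value elsewhere is irrelevant, as only
  -- positive arguments occur below.
  log₂ : Carrier → Carrier
  log₂ a = sup (ExponentBelow a)

  record Prior (X : FiniteSet) : Set ℓ where
    field
      prob   : Elem X → Carrier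
      nonNeg : ∀ x → 0# ≤ prob x
      total  : ∑ X prob ≈ 1#

  record Channel (X Y : FiniteSet) : Set ℓ where
    field
      entry  : Elem X → Elem Y → Carrier
      nonNeg : ∀ x y → 0# ≤ entry x y
      total  : ∀ x → ∑ Y (entry x) ≈ 1#

  open Prior
  open Channel

  private
    module S where
      open import Algebra.Properties.Semiring.Sum semiring public
        using (sum-cong-≋; *-distribˡ-sum; *-distribʳ-sum)
      open CommutativeRing commutativeRing public
        using (setoid; refl; sym; trans; reflexive; +-congˡ; +-cong; +-assoc; +-identityˡ; *-cong; *-identityˡ)
    open import Relation.Binary.Reasoning.Setoid S.setoid

    sum-++ : ∀ m n (f : Fin (m ℕ.+ n) → Carrier) →
             sum f ≈ sum (λ i → f (i ↑ˡ n)) + sum (λ j → f (m ↑ʳ j))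
    sum-++ zero    n f = S.sym (S.+-identityˡ _)
    sum-++ (suc m) n f =
      S.trans (S.+-congˡ (sum-++ m n (f ∘ suc))) (S.sym (S.+-assoc _ _ _))

    sum-combine : ∀ m n (f : Fin (m ℕ.* n) → Carrier) →
                  sum f ≈ sum {m} (λ i → sum {n} (λ j → f (combine i j)))
    sum-combine zero    n f = S.refl
    sum-combine (suc m) n f =
      S.trans (sum-++ n (m ℕ.* n) f) (S.+-congˡ (sum-combine m n (λ k → f (n ↑ʳ k))))

  ∑-× : ∀ X Y (f : Elem X × Elem Y → Carrier) →
        ∑ (X ×ᶠ Y) f ≈ ∑ X (λ x → ∑ Y (λ y → f (x , y)))
  ∑-× X Y f = S.trans
    (sum-combine (suc (size-1 X)) (suc (size-1 Y)) (f ∘ enum (X ×ᶠ Y)))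
    (S.sum-cong-≋ (λ i → S.sum-cong-≋ (λ j → S.reflexive
      (≡.cong (λ (k , l) → f (enum X k , enum Y l)) (remQuot-combine i j)))))

  infixr 5 _∥_

  _∥_ : ∀ {X Y₁ Y₂} → Channel X Y₁ → Channel X Y₂ → Channel X (Y₁ ×ᶠ Y₂)
  _∥_ {X} {Y₁} {Y₂} C₁ C₂ = record
    { entry  = λ x (y₁ , y₂) → entry C₁ x y₁ * entry C₂ x y₂
    ; nonNeg = λ x (y₁ , y₂) → *-nonNeg (nonNeg C₁ x y₁) (nonNeg C₂ x y₂)
    ; total  = λ x → begin
        ∑ (Y₁ ×ᶠ Y₂) (λ (y₁ , y₂) → entry C₁ x y₁ * entry C₂ x y₂)
          ≈⟨ ∑-× Y₁ Y₂ (λ (y₁ , y₂) → entry C₁ x y₁ * entry C₂ x y₂) ⟩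
        ∑ Y₁ (λ y₁ → ∑ Y₂ (λ y₂ → entry C₁ x y₁ * entry C₂ x y₂))
          ≈⟨ S.sum-cong-≋ (λ i →
             S.*-distribˡ-sum (entry C₁ x (enum Y₁ i)) (entry C₂ x ∘ enum Y₂)) ⟨
        ∑ Y₁ (λ y₁ → entry C₁ x y₁ * ∑ Y₂ (entry C₂ x))
          ≈⟨ S.*-distribʳ-sum (∑ Y₂ (entry C₂ x)) (entry C₁ x ∘ enum Y₁) ⟨
        ∑ Y₁ (entry C₁ x) * ∑ Y₂ (entry C₂ x)
          ≈⟨ S.*-cong (total C₁ x) (total C₂ x) ⟩
        1# * 1#
          ≈⟨ S.*-identityˡ 1# ⟩
        1# ∎
    }

  V : ∀ {X} → Prior X → Carrier
  V {X} π = maximum X (prob π)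

  V[_,_] : ∀ {X Y} → Prior X → Channel X Y → Carrier
  V[_,_] {X} {Y} π C = ∑ Y (λ y → maximum X (λ x → prob π x * entry C x y))

  -- The largest probability V π is itself nonzero, so using it as the seed of
  -- the minimum adds nothing to the set { π[x] : π[x] ≠ 0 }.
  minProb : ∀ {X} → Prior X → Carrier
  minProb {X} π =
    Extrema.min (V π) (filter (λ p → ¬? (p ≟ 0#)) (tabulate (prob π ∘ enum X)))

  H∞ : ∀ {X} → Prior X → Carrier
  H∞ π = - log₂ (V π)

  H∞[_,_] : ∀ {X Y} → Prior X → Channel X Y → Carrier
  H∞[ π , C ] = - log₂ V[ π , C ]

  I∞[_,_] : ∀ {X Y} → Prior X → Channel X Y → Carrier
  I∞[ π , C ] = H∞ π - H∞[ π , C ]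

  Hᵐⁱⁿ : ∀ {X} → Prior X → Carrier
  Hᵐⁱⁿ π = - log₂ (minProb π)

{-# OPTIONS --safe #-}

-- For m the least nonzero probability, m π[x] ≤ π[x]² at every x, so
-- m V(π, C₁ ∥ C₂) ≤ V(π, C₁) V(π, C₂); taking logarithms gives (1), and (4) is
-- (1) rearranged.  Summing out one output inside the maximum gives
-- V(π, Cᵢ) ≤ V(π, C₁ ∥ C₂), which is (2) and (3).
--
-- As log₂ is a supremum of rational exponents, log₂ (a * b) ≤ log₂ a + log₂ b
-- is the delicate half of the functional equation: it is obtained up to an
-- error 2/N by comparing the powers a^N and b^N with powers of 2.
module Submission where

open import Defs
open import Algebra.Bundles using (CommutativeRing)
open import Data.Fin.Base using (Fin; zero; suc)
open import Data.List.Base using (List; tabulate)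
import Data.List.Extrema as ListExtrema
import Data.List.Relation.Unary.All as All
import Data.List.Relation.Unary.All.Properties as All
open import Data.List.Membership.Propositional.Properties using (∈-filter⁺; ∈-tabulate⁺)
open import Data.Nat.Base using (zero; suc; z≤n; s≤s)
import Data.Nat.Base as ℕ
import Data.Nat.Properties as ℕₚ
open import Data.Product.Base using (∃; ∃-syntax; _×_; _,_; proj₁; proj₂)
open import Data.Sum.Base using (inj₁; inj₂)
open import Function.Base using (_∘_; id)
open import Function.Bundles using (module Inverse)
open import Level using (Level)
open import Relation.Binary.Bundles using (DecTotalOrder)
import Relation.Binary.PropositionalEquality as ≡
open import Relation.Nullary.Decidable using (yes; no; ¬?; decidable-stable)
open import Relation.Nullary.Negation using (¬_)

-- Order arithmetic in a complete ordered field, up to the Archimedean property.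

module OrderedFieldProperties {ℓ : Level} (ℝ : CompleteOrderedField ℓ) where

  open CompleteOrderedField ℝ public
  open CommutativeRing commutativeRing public
    using ( commutativeSemiring; +-commutativeMonoid; ring; +-abelianGroup
          ; +-cong; +-congˡ; +-congʳ; +-comm; +-assoc; +-identityˡ; +-identityʳ
          ; -‿cong; -‿inverseˡ; -‿inverseʳ
          ; *-cong; *-congˡ; *-congʳ; *-comm; *-assoc; *-identityˡ; *-identityʳ
          ; zeroˡ; zeroʳ )
  open DecTotalOrder decTotalOrder public
    using (poset; module Eq; _≤?_; total; antisym)
    renaming (refl to ≤-refl; reflexive to ≤-reflexive; trans to ≤-trans)
  open import Relation.Binary.Properties.DecTotalOrder decTotalOrder public
    using (_<_)
  open import Relation.Binary.Properties.TotalOrder totalOrder public using (≰⇒≥)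
  open import Algebra.Properties.Ring ring public using ([y-z]x≈yx-zx)
  open import Algebra.Properties.AbelianGroup +-abelianGroup public
    using ()
    renaming ( ⁻¹-involutive to -‿involutive
             ; ⁻¹-∙-comm to -‿+-comm
             ; ⁻¹-anti-homo‿- to -‿anti-homo-- )
  open import Algebra.Properties.Semiring.Mult semiring public
    using (×-congʳ; ×-congˡ; ×-homo-+; ×-assocˡ; ×-assoc-*)
    renaming (_×_ to _·_)
  open import Algebra.Properties.CommutativeMonoid.Mult +-commutativeMonoid public
    using (×-distrib-+)
  open import Algebra.Properties.CommutativeSemiring.Exp commutativeSemiring public
    using (_^_; ^-congʳ; ^-homo-*; ^-assocʳ; ^-distrib-*)
  open import Algebra.Solver.Ring.NaturalCoefficients.Default commutativeSemiring public
    using (solve; _:=_; _:+_; _:*_; con)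
  open import Relation.Binary.Reasoning.PartialOrder poset public

  <⇒≱ : ∀ {x y} → x < y → ¬ (y ≤ x)
  <⇒≱ (x≤y , x≉y) y≤x = x≉y (antisym x≤y y≤x)

  +-monoʳ-≤ : ∀ {x y} z → x ≤ y → z + x ≤ z + y
  +-monoʳ-≤ {x} {y} z x≤y = begin
    z + x ≈⟨ +-comm z x ⟩
    x + z ≤⟨ +-monoˡ-≤ z x≤y ⟩
    y + z ≈⟨ +-comm y z ⟩
    z + y ∎

  +-mono-≤ : ∀ {x y u v} → x ≤ y → u ≤ v → x + u ≤ y + v
  +-mono-≤ {y = y} {u} x≤y u≤v = ≤-trans (+-monoˡ-≤ u x≤y) (+-monoʳ-≤ y u≤v)

  x+y-y≈x : ∀ x y → x + y - y ≈ x
  x+y-y≈x x y = Eq.trans (+-assoc x y (- y)) (Eq.trans (+-congˡ (-‿inverseʳ y)) (+-identityʳ x))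

  x-y+y≈x : ∀ x y → x - y + y ≈ x
  x-y+y≈x x y = Eq.trans (+-assoc x (- y) y) (Eq.trans (+-congˡ (-‿inverseˡ y)) (+-identityʳ x))

  x+y≤z⇒x≤z-y : ∀ {x y z} → x + y ≤ z → x ≤ z - y
  x+y≤z⇒x≤z-y {x} {y} {z} p = begin
    x         ≈⟨ x+y-y≈x x y ⟨
    x + y - y ≤⟨ +-monoˡ-≤ (- y) p ⟩
    z - y     ∎

  x≤z-y⇒x+y≤z : ∀ {x y z} → x ≤ z - y → x + y ≤ z
  x≤z-y⇒x+y≤z {x} {y} {z} p = begin
    x + y     ≤⟨ +-monoˡ-≤ y p ⟩
    z - y + y ≈⟨ x-y+y≈x z y ⟩
    z         ∎

  +-cancelʳ-≤ : ∀ {x y} z → x + z ≤ y + z → x ≤ y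
  +-cancelʳ-≤ {x} {y} z p = ≤-trans (x+y≤z⇒x≤z-y p) (≤-reflexive (x+y-y≈x y z))

  x+y≤x⇒y≤0 : ∀ {x y} → x + y ≤ x → y ≤ 0#
  x+y≤x⇒y≤0 {x} {y} p = +-cancelʳ-≤ x (begin
    y + x  ≈⟨ +-comm y x ⟩
    x + y  ≤⟨ p ⟩
    x      ≈⟨ +-identityˡ x ⟨
    0# + x ∎)

  x≤y⇒0≤y-x : ∀ {x y} → x ≤ y → 0# ≤ y - x
  x≤y⇒0≤y-x {x} x≤y = x+y≤z⇒x≤z-y (≤-trans (≤-reflexive (+-identityˡ x)) x≤y)

  0≤y-x⇒x≤y : ∀ {x y} → 0# ≤ y - x → x ≤ y
  0≤y-x⇒x≤y {x} p = ≤-trans (≤-reflexive (Eq.sym (+-identityˡ x))) (x≤z-y⇒x+y≤z p)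

  *-monoˡ-≤ : ∀ {x y z} → 0# ≤ z → x ≤ y → x * z ≤ y * z
  *-monoˡ-≤ {x} {y} {z} 0≤z x≤y = 0≤y-x⇒x≤y (begin
    0#            ≤⟨ *-nonNeg (x≤y⇒0≤y-x x≤y) 0≤z ⟩
    (y - x) * z   ≈⟨ [y-z]x≈yx-zx z y x ⟩
    y * z - x * z ∎)

  *-monoʳ-≤ : ∀ {x y z} → 0# ≤ z → x ≤ y → z * x ≤ z * y
  *-monoʳ-≤ {x} {y} {z} 0≤z x≤y = begin
    z * x ≈⟨ *-comm z x ⟩
    x * z ≤⟨ *-monoˡ-≤ 0≤z x≤y ⟩
    y * z ≈⟨ *-comm y z ⟩
    z * y ∎

  *-mono-≤ : ∀ {x y u v} → 0# ≤ y → 0# ≤ u → x ≤ y → u ≤ v → x * u ≤ y * v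
  *-mono-≤ 0≤y 0≤u x≤y u≤v = ≤-trans (*-monoˡ-≤ 0≤u x≤y) (*-monoʳ-≤ 0≤y u≤v)

  x≤z+y⇒x-y≤z : ∀ {x y z} → x ≤ z + y → x - y ≤ z
  x≤z+y⇒x-y≤z {x} {y} {z} p = ≤-trans (+-monoˡ-≤ (- y) p) (≤-reflexive (x+y-y≈x z y))

  neg-anti-≤ : ∀ {x y} → x ≤ y → - y ≤ - x
  neg-anti-≤ {x} {y} x≤y = +-cancelʳ-≤ y (begin
    - y + y   ≈⟨ -‿inverseˡ y ⟩
    0#        ≤⟨ x≤y⇒0≤y-x x≤y ⟩
    y - x     ≈⟨ +-comm y (- x) ⟩
    - x + y   ∎)

  -- If `1# ≤ 0#`, then `-1` is nonnegative and so is its square, which is `1#`.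
  0≤1 : 0# ≤ 1#
  0≤1 with total 0# 1#
  ... | inj₁ 0≤1 = 0≤1
  ... | inj₂ 1≤0 = 0≤y-x⇒x≤y (begin
    0#                    ≤⟨ *-nonNeg 0≤-1 0≤-1 ⟩
    (0# - 1#) * (0# - 1#) ≈⟨ [y-z]x≈yx-zx (0# - 1#) 0# 1# ⟩
    0# * (0# - 1#) - 1# * (0# - 1#)
      ≈⟨ +-cong (zeroˡ _) (-‿cong (Eq.trans (*-identityˡ _) (+-identityˡ _))) ⟩
    0# - (- 1#)           ≈⟨ +-identityˡ _ ⟩
    - (- 1#)              ≈⟨ -‿involutive 1# ⟩
    1#                    ≈⟨ x+y-y≈x 1# 0# ⟨
    1# + 0# - 0#          ≈⟨ +-congʳ (+-identityʳ 1#) ⟩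
    1# - 0#               ∎)
    where
    0≤-1 = x≤y⇒0≤y-x 1≤0

  0<1 : 0# < 1#
  0<1 = 0≤1 , λ 0≈1 → 1≉0 (Eq.sym 0≈1)

  ·-monoʳ-≤ : ∀ {x y} n → x ≤ y → n · x ≤ n · y
  ·-monoʳ-≤ zero    x≤y = ≤-refl
  ·-monoʳ-≤ (suc n) x≤y = +-mono-≤ x≤y (·-monoʳ-≤ n x≤y)

  ·-nonNeg : ∀ {x} n → 0# ≤ x → 0# ≤ n · x
  ·-nonNeg zero    0≤x = ≤-refl
  ·-nonNeg (suc n) 0≤x =
    ≤-trans (≤-reflexive (Eq.sym (+-identityˡ 0#))) (+-mono-≤ 0≤x (·-nonNeg n 0≤x))

  ·-cancelˡ-≤ : ∀ {x y} n → suc n · x ≤ suc n · y → x ≤ y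
  ·-cancelˡ-≤ {x} {y} n p with total x y
  ... | inj₁ x≤y = x≤y
  -- Replacing `n · y` on the right by the larger `n · x` leaves a common summand to cancel.
  ... | inj₂ y≤x = +-cancelʳ-≤ (n · x) (≤-trans p (+-monoʳ-≤ y (·-monoʳ-≤ n y≤x)))

  m≤n⇒m·1≤n·1 : ∀ {m n} → m ℕ.≤ n → m · 1# ≤ n · 1#
  m≤n⇒m·1≤n·1 {n = n} z≤n = ·-nonNeg n 0≤1
  m≤n⇒m·1≤n·1 (s≤s m≤n)   = +-monoʳ-≤ 1# (m≤n⇒m·1≤n·1 m≤n)

  0<suc·1 : ∀ n → 0# < suc n · 1#
  0<suc·1 n = 0≤ , λ 0≈ → <⇒≱ 0<1 (begin
    1#         ≈⟨ +-identityʳ 1# ⟨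
    1# + 0#    ≤⟨ +-monoʳ-≤ 1# (·-nonNeg n 0≤1) ⟩
    suc n · 1# ≈⟨ 0≈ ⟨
    0#         ∎)
    where 0≤ = ·-nonNeg (suc n) 0≤1

  ^-nonNeg : ∀ {x} n → 0# ≤ x → 0# ≤ x ^ n
  ^-nonNeg zero    0≤x = 0≤1
  ^-nonNeg (suc n) 0≤x = *-nonNeg 0≤x (^-nonNeg n 0≤x)

  ^-monoˡ-≤ : ∀ {x y} n → 0# ≤ x → x ≤ y → x ^ n ≤ y ^ n
  ^-monoˡ-≤ zero    0≤x x≤y = ≤-refl
  ^-monoˡ-≤ (suc n) 0≤x x≤y =
    *-mono-≤ (≤-trans 0≤x x≤y) (^-nonNeg n 0≤x) x≤y (^-monoˡ-≤ n 0≤x x≤y)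

  -- The supremum of the multiples of x would be at least x above itself.
  archimedean : ∀ {x y} → 0# < x → ¬ (∀ n → suc n · x ≤ y)
  archimedean {x} {y} 0<x bounded = <⇒≱ 0<x (x+y≤x⇒y≤0 (x≤z-y⇒x+y≤z s≤s-x))
    where
    Multiple : Carrier → Set ℓ
    Multiple z = ∃[ n ] z ≈ suc n · x

    inhabited : ∃ Multiple
    inhabited = 1 · x , 0 , Eq.refl

    bound : ∃ (UpperBound Multiple)
    bound = y , λ z (n , z≈) → ≤-trans (≤-reflexive z≈) (bounded n)

    s : Carrier
    s = sup Multiple

    s≤s-x : s ≤ s - x
    s≤s-x = sup-least Multiple inhabited bound (s - x) λ z (n , z≈) →
      x+y≤z⇒x≤z-y (begin
        z + x             ≈⟨ +-comm z x ⟩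
        x + z             ≈⟨ +-congˡ z≈ ⟩
        suc (suc n) · x   ≤⟨ sup-upper Multiple inhabited bound _ (suc n , Eq.refl) ⟩
        s                 ∎)

  -- Otherwise all multiples of the positive number `x - y` would be bounded by `z`. This stands in
  -- for dividing by `suc n` and letting `n` tend to infinity.
  ·-≤-slack⇒≤ : ∀ {x y z} → (∀ n → suc n · x ≤ suc n · y + z) → x ≤ y
  ·-≤-slack⇒≤ {x} {y} {z} p = decidable-stable (x ≤? y) λ x≰y →
    archimedean (0<x-y x≰y) λ n → +-cancelʳ-≤ (suc n · y) (begin
      suc n · (x - y) + suc n · y ≈⟨ ×-distrib-+ (x - y) y (suc n) ⟨
      suc n · (x - y + y)         ≈⟨ ×-congʳ (suc n) (x-y+y≈x x y) ⟩
      suc n · x                   ≤⟨ p n ⟩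
      suc n · y + z               ≈⟨ +-comm _ z ⟩
      z + suc n · y               ∎)
    where
    0<x-y : ¬ (x ≤ y) → 0# < x - y
    0<x-y x≰y = x≤y⇒0≤y-x (≰⇒≥ x≰y) , λ 0≈x-y → x≰y (begin
      x         ≈⟨ x-y+y≈x x y ⟨
      x - y + y ≈⟨ +-congʳ 0≈x-y ⟨
      0# + y    ≈⟨ +-identityˡ y ⟩
      y         ∎)

-- The base-2 logarithm: monotonicity and the functional equation.

module LogarithmProperties {ℓ : Level} (ℝ : CompleteOrderedField ℓ) where

  open OrderedFieldProperties ℝ
  open Leakage ℝ using (ExponentBelow; log₂)

  2# : Carrier
  2# = 1# + 1#

  0≤2 : 0# ≤ 2#
  0≤2 = ≤-trans 0≤1 (≤-trans (≤-reflexive (Eq.sym (+-identityʳ 1#))) (+-monoʳ-≤ 1# 0≤1))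

  0≤2^ : ∀ n → 0# ≤ 2# ^ n
  0≤2^ n = ^-nonNeg n 0≤2

  2^suc : ∀ n → 2# ^ suc n ≈ 2# ^ n + 2# ^ n
  2^suc n = solve 1 (λ t → con 2 :* t := t :+ t) Eq.refl (2# ^ n)

  2^n≤2^suc-n : ∀ n → 2# ^ n ≤ 2# ^ suc n
  2^n≤2^suc-n n = begin
    2# ^ n          ≈⟨ +-identityʳ _ ⟨
    2# ^ n + 0#     ≤⟨ +-monoʳ-≤ _ (0≤2^ n) ⟩
    2# ^ n + 2# ^ n ≈⟨ 2^suc n ⟨
    2# ^ suc n      ∎

  1≤2^ : ∀ n → 1# ≤ 2# ^ n
  1≤2^ zero    = ≤-refl
  1≤2^ (suc n) = ≤-trans (1≤2^ n) (2^n≤2^suc-n n)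

  n·1≤2^n : ∀ n → n · 1# ≤ 2# ^ n
  n·1≤2^n zero    = 0≤1
  n·1≤2^n (suc n) = begin
    1# + n · 1#     ≤⟨ +-mono-≤ (1≤2^ n) (n·1≤2^n n) ⟩
    2# ^ n + 2# ^ n ≈⟨ 2^suc n ⟨
    2# ^ suc n      ∎

  2^-monoʳ-≤ : ∀ {m n} → m ℕ.≤ n → 2# ^ m ≤ 2# ^ n
  2^-monoʳ-≤ {n = n} z≤n = 1≤2^ n
  2^-monoʳ-≤ (s≤s m≤n)   = *-monoʳ-≤ 0≤2 (2^-monoʳ-≤ m≤n)

  -- If `n < m`, then twice `2# ^ n` is at most `2# ^ n`, which forces `2# ^ n ≤ 0#`. This carries
  -- comparisons from the field back to natural exponents.
  2^-cancel-≤ : ∀ {m n} → 2# ^ m ≤ 2# ^ n → m ℕ.≤ n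
  2^-cancel-≤ {m} {n} p = ℕₚ.≮⇒≥ λ n<m →
    <⇒≱ 0<1 (≤-trans (1≤2^ n) (x+y≤x⇒y≤0 (begin
      2# ^ n + 2# ^ n ≈⟨ 2^suc n ⟨
      2# ^ suc n      ≤⟨ 2^-monoʳ-≤ n<m ⟩
      2# ^ m          ≤⟨ p ⟩
      2# ^ n          ∎)))

  -- An explicit form of positivity, `2^(-r) ≤ a ≤ 2^q`: exactly the witnesses that make
  -- `ExponentBelow a` inhabited and bounded, so that the axioms on `sup` apply.
  record DyadicBounds (a : Carrier) : Set ℓ where
    field
      nonNeg : 0# ≤ a
      lower  : ∃[ r ] 1# ≤ 2# ^ r * a
      upper  : ∃[ q ] a ≤ 2# ^ q

  open DyadicBounds

  -- The Archimedean property is only available in negated form, hence the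
  -- double negation.
  dyadicBounds : ∀ {a} → 0# < a → ¬ ¬ DyadicBounds a
  dyadicBounds {a} 0<a@(0≤a , _) ¬bounds =
    archimedean 0<a λ m → ≰⇒≥ λ 1≤m·a →
    archimedean 0<1 λ n → ≰⇒≥ λ a≤n·1 →
    ¬bounds record
      { nonNeg = 0≤a
      ; lower  = suc m , (begin
          1#                ≤⟨ 1≤m·a ⟩
          suc m · a         ≈⟨ ×-congʳ (suc m) (*-identityˡ a) ⟨
          suc m · (1# * a)  ≈⟨ ×-assoc-* (suc m) 1# a ⟨
          suc m · 1# * a    ≤⟨ *-monoˡ-≤ 0≤a (n·1≤2^n (suc m)) ⟩
          2# ^ suc m * a    ∎)
      ; upper  = suc n , ≤-trans a≤n·1 (n·1≤2^n (suc n))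
      }

  dyadicBounds-1 : DyadicBounds 1#
  dyadicBounds-1 = record
    { nonNeg = 0≤1
    ; lower  = 0 , ≤-reflexive (Eq.sym (*-identityˡ 1#))
    ; upper  = 0 , ≤-refl
    }

  dyadicBounds-* : ∀ {a b} → DyadicBounds a → DyadicBounds b → DyadicBounds (a * b)
  dyadicBounds-* {a} {b} A B with lower A | lower B | upper A | upper B
  ... | r , 1≤a | s , 1≤b | p , a≤ | q , b≤ = record
    { nonNeg = *-nonNeg (nonNeg A) (nonNeg B)
    ; lower  = r ℕ.+ s , (begin
        1#                              ≈⟨ *-identityˡ 1# ⟨
        1# * 1#                         ≤⟨ *-mono-≤ (≤-trans 0≤1 1≤a) 0≤1 1≤a 1≤b ⟩
        (2# ^ r * a) * (2# ^ s * b)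
          ≈⟨ solve 4 (λ r a s b → (r :* a) :* (s :* b) := (r :* s) :* (a :* b))
               Eq.refl (2# ^ r) a (2# ^ s) b ⟩
        (2# ^ r * 2# ^ s) * (a * b)     ≈⟨ *-congʳ (^-homo-* 2# r s) ⟨
        2# ^ (r ℕ.+ s) * (a * b)        ∎)
    ; upper  = p ℕ.+ q , (begin
        a * b                           ≤⟨ *-mono-≤ (0≤2^ p) (nonNeg B) a≤ b≤ ⟩
        2# ^ p * 2# ^ q                 ≈⟨ ^-homo-* 2# p q ⟨
        2# ^ (p ℕ.+ q)                  ∎)
    }

  dyadicBounds-^ : ∀ {a} n → DyadicBounds a → DyadicBounds (a ^ n)
  dyadicBounds-^ zero    A = dyadicBounds-1
  dyadicBounds-^ (suc n) A = dyadicBounds-* A (dyadicBounds-^ n A)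

  -- An integer approximation: `p - r ≤ log₂ a ≤ p - r + 1`. Scaling by `2# ^ r` brings `a` above
  -- `1#`; the exponent of the upper bound is then lowered one at a time until the power of 2 falls
  -- below the scaled value.
  dyadicFloor : ∀ {a} → DyadicBounds a →
                ∃[ r ] ∃[ p ] (2# ^ p ≤ 2# ^ r * a) × (2# ^ r * a ≤ 2# ^ suc p)
  dyadicFloor {a} A with lower A | upper A
  ... | r , 1≤d | q , a≤ = r , floor (r ℕ.+ q) (begin
    2# ^ r * a      ≤⟨ *-monoʳ-≤ (0≤2^ r) a≤ ⟩
    2# ^ r * 2# ^ q ≈⟨ ^-homo-* 2# r q ⟨
    2# ^ (r ℕ.+ q)  ∎)
    where
    floor : ∀ q → 2# ^ r * a ≤ 2# ^ q →
            ∃[ p ] (2# ^ p ≤ 2# ^ r * a) × (2# ^ r * a ≤ 2# ^ suc p)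
    -- The scaled value is now at most `1#`, and by `lower` it is at least `1#`, so the exponent 0
    -- serves.
    floor zero    d≤ = 0 , 1≤d , ≤-trans d≤ (2^n≤2^suc-n 0)
    floor (suc q) d≤ with total (2# ^ r * a) (2# ^ q)
    ... | inj₁ d≤2^q = floor q d≤2^q
    ... | inj₂ 2^q≤d = q , 2^q≤d , d≤

  -- Supplies `(p - r) / suc n` in the division-free form that `ExponentBelow` uses.
  fraction : ∀ n r p → ∃[ w ] (suc n · w + r · 1# ≈ p · 1#)
  fraction n r p with inverse (suc n · 1#) (λ N≈0 → proj₂ (0<suc·1 n) (Eq.sym N≈0))
  ... | y , Ny≈1 = y * d , Eq.trans (+-congʳ N·yd≈d) (x-y+y≈x (p · 1#) (r · 1#))
    where
    d : Carrier
    d = p · 1# - r · 1#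

    N·yd≈d : suc n · (y * d) ≈ d
    N·yd≈d = begin-equality
      suc n · (y * d)        ≈⟨ ×-congʳ (suc n) (*-identityˡ (y * d)) ⟨
      suc n · (1# * (y * d)) ≈⟨ ×-assoc-* (suc n) 1# (y * d) ⟨
      suc n · 1# * (y * d)   ≈⟨ *-assoc (suc n · 1#) y d ⟨
      suc n · 1# * y * d     ≈⟨ *-congʳ Ny≈1 ⟩
      1# * d                 ≈⟨ *-identityˡ d ⟩
      d                      ∎

  -- Such combinations are the numerators of two fractions brought over a common denominator;
  -- `2^[a*m+b*n]` is the exponential counterpart.
  [a*m+b*n]·1 : ∀ a m b n → (a ℕ.* m ℕ.+ b ℕ.* n) · 1# ≈ m · (a · 1#) + n · (b · 1#)
  [a*m+b*n]·1 a m b n = Eq.trans (×-homo-+ 1# (a ℕ.* m) (b ℕ.* n)) (+-cong (comm a m) (comm b n))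
    where
    comm : ∀ a m → (a ℕ.* m) · 1# ≈ m · (a · 1#)
    comm a m = Eq.trans (×-congˡ (ℕₚ.*-comm a m)) (Eq.sym (×-assocˡ 1# m a))

  2^[a*m+b*n] : ∀ a m b n → 2# ^ (a ℕ.* m ℕ.+ b ℕ.* n) ≈ (2# ^ a) ^ m * (2# ^ b) ^ n
  2^[a*m+b*n] a m b n = Eq.trans (^-homo-* 2# (a ℕ.* m) (b ℕ.* n))
    (*-cong (Eq.sym (^-assocʳ 2# a m)) (Eq.sym (^-assocʳ 2# b n)))

  ^-exchange : ∀ x m n → (x ^ m) ^ n ≈ (x ^ n) ^ m
  ^-exchange x m n = begin-equality
    (x ^ m) ^ n   ≈⟨ ^-assocʳ x m n ⟩
    x ^ (m ℕ.* n) ≈⟨ ^-congʳ x (ℕₚ.*-comm m n) ⟩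
    x ^ (n ℕ.* m) ≈⟨ ^-assocʳ x n m ⟨
    (x ^ n) ^ m   ∎

  -- The converse half of the cut: w is an upper bound as soon as a ≤ 2^w, where
  -- w = (u - t) / suc n.
  exponentAbove : ∀ {a w} n t u → 0# ≤ a → suc n · w + t · 1# ≈ u · 1# →
                  2# ^ t * a ^ suc n ≤ 2# ^ u → UpperBound (ExponentBelow a) w
  exponentAbove {a} {w} n t u 0≤a w≈ a≤2^w v (q , s , m , v≈ , 2^v≤a) =
    -- With both denominators cleared and the subtracted terms moved across, `v ≤ w` becomes the
    -- inequality `q N + t M ≤ s N + u M` of natural numbers, which is read off from the powers of
    -- 2.
    ·-cancelˡ-≤ m (·-cancelˡ-≤ n (+-cancelʳ-≤ (N · (s · 1#) + M · (t · 1#)) (begin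
      N · (M · v) + (N · (s · 1#) + M · (t · 1#))
        ≈⟨ +-assoc _ _ _ ⟨
      N · (M · v) + N · (s · 1#) + M · (t · 1#)
        ≈⟨ +-congʳ (×-distrib-+ (M · v) (s · 1#) N) ⟨
      N · (M · v + s · 1#) + M · (t · 1#)
        ≈⟨ +-congʳ (×-congʳ N v≈) ⟩
      N · (q · 1#) + M · (t · 1#)
        ≈⟨ [a*m+b*n]·1 q N t M ⟨
      (q ℕ.* N ℕ.+ t ℕ.* M) · 1#
        ≤⟨ m≤n⇒m·1≤n·1 (2^-cancel-≤ {q ℕ.* N ℕ.+ t ℕ.* M} {s ℕ.* N ℕ.+ u ℕ.* M} powers) ⟩
      (s ℕ.* N ℕ.+ u ℕ.* M) · 1#
        ≈⟨ [a*m+b*n]·1 s N u M ⟩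
      N · (s · 1#) + M · (u · 1#)
        ≈⟨ +-congˡ (×-congʳ M w≈) ⟨
      N · (s · 1#) + M · (N · w + t · 1#)
        ≈⟨ +-congˡ (×-distrib-+ (N · w) (t · 1#) M) ⟩
      N · (s · 1#) + (M · (N · w) + M · (t · 1#))
        ≈⟨ solve 3 (λ s w t → s :+ (w :+ t) := w :+ (s :+ t)) Eq.refl _ _ _ ⟩
      M · (N · w) + (N · (s · 1#) + M · (t · 1#))
        ≈⟨ +-congʳ (·-exchange M N w) ⟩
      N · (M · w) + (N · (s · 1#) + M · (t · 1#)) ∎)))
    where
    N = suc n
    M = suc m

    ·-exchange : ∀ m n x → m · (n · x) ≈ n · (m · x)
    ·-exchange m n x = Eq.trans (×-assocˡ x m n)
      (Eq.trans (×-congˡ (ℕₚ.*-comm m n)) (Eq.sym (×-assocˡ x n m)))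

    -- The bound for `v` is raised to the power `N` and the bound for `w` to the power `M`, so that
    -- both involve the same power of `a`.
    powers : 2# ^ (q ℕ.* N ℕ.+ t ℕ.* M) ≤ 2# ^ (s ℕ.* N ℕ.+ u ℕ.* M)
    powers = begin
      2# ^ (q ℕ.* N ℕ.+ t ℕ.* M)
        ≈⟨ 2^[a*m+b*n] q N t M ⟩
      (2# ^ q) ^ N * (2# ^ t) ^ M
        ≤⟨ *-monoˡ-≤ (^-nonNeg M (0≤2^ t)) (^-monoˡ-≤ N (0≤2^ q) 2^v≤a) ⟩
      (2# ^ s * a ^ M) ^ N * (2# ^ t) ^ M
        ≈⟨ *-congʳ (^-distrib-* (2# ^ s) (a ^ M) N) ⟩
      (2# ^ s) ^ N * (a ^ M) ^ N * (2# ^ t) ^ M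
        ≈⟨ *-congʳ (*-congˡ (^-exchange a M N)) ⟩
      (2# ^ s) ^ N * (a ^ N) ^ M * (2# ^ t) ^ M
        ≈⟨ solve 3 (λ s a t → s :* a :* t := s :* (t :* a)) Eq.refl _ _ _ ⟩
      (2# ^ s) ^ N * ((2# ^ t) ^ M * (a ^ N) ^ M)
        ≈⟨ *-congˡ (^-distrib-* (2# ^ t) (a ^ N) M) ⟨
      (2# ^ s) ^ N * (2# ^ t * a ^ N) ^ M
        ≤⟨ *-monoʳ-≤ (^-nonNeg N (0≤2^ s))
             (^-monoˡ-≤ M (*-nonNeg (0≤2^ t) (^-nonNeg N 0≤a)) a≤2^w) ⟩
      (2# ^ s) ^ N * (2# ^ u) ^ M
        ≈⟨ 2^[a*m+b*n] s N u M ⟨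
      2# ^ (s ℕ.* N ℕ.+ u ℕ.* M) ∎

  exponentBelow-inhabited : ∀ {a} → DyadicBounds a → ∃ (ExponentBelow a)
  exponentBelow-inhabited {a} A with lower A
  -- The exponent is `w = - r`, since `lower` says `2^(-r) ≤ a`. Dually, `upper` yields the bound
  -- `w = q` in `exponentBelow-bounded`.
  ... | r , 1≤ with fraction 0 r 0
  ... | w , w≈ = w , 0 , r , 0 , w≈ , ≤-trans 1≤ (≤-reflexive (*-congˡ (Eq.sym (*-identityʳ a))))

  exponentBelow-bounded : ∀ {a} → DyadicBounds a → ∃ (UpperBound (ExponentBelow a))
  exponentBelow-bounded {a} A with upper A
  ... | q , a≤ with fraction 0 0 q
  ... | w , w≈ = w , exponentAbove 0 0 q (nonNeg A) w≈ (begin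
    1# * (a * 1#) ≈⟨ *-identityˡ _ ⟩
    a * 1#        ≈⟨ *-identityʳ a ⟩
    a             ≤⟨ a≤ ⟩
    2# ^ q        ∎)

  log₂-upper : ∀ {a} → DyadicBounds a → UpperBound (ExponentBelow a) (log₂ a)
  log₂-upper A = sup-upper _ (exponentBelow-inhabited A) (exponentBelow-bounded A)

  log₂-least : ∀ {a} → DyadicBounds a → ∀ u → UpperBound (ExponentBelow a) u → log₂ a ≤ u
  log₂-least A = sup-least _ (exponentBelow-inhabited A) (exponentBelow-bounded A)

  exponentBelow-mono : ∀ {a b w} → 0# ≤ a → a ≤ b → ExponentBelow a w → ExponentBelow b w
  exponentBelow-mono 0≤a a≤b (p , r , n , w≈ , 2^w≤a) =
    p , r , n , w≈ , ≤-trans 2^w≤a (*-monoʳ-≤ (0≤2^ r) (^-monoˡ-≤ (suc n) 0≤a a≤b))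

  exponentBelow-* : ∀ {a b v w} → ExponentBelow a v → ExponentBelow b w →
                    ExponentBelow (a * b) (v + w)
  exponentBelow-* {a} {b} {v} {w} (p , r , n , v≈ , 2^v≤a) (q , s , m , w≈ , 2^w≤b) =
    -- The two fractions are added over the denominator `N * M`, whose predecessor is `m + n * M`.
    p ℕ.* M ℕ.+ q ℕ.* N , r ℕ.* M ℕ.+ s ℕ.* N , m ℕ.+ n ℕ.* M , v+w≈ , (begin
      2# ^ (p ℕ.* M ℕ.+ q ℕ.* N)
        ≈⟨ 2^[a*m+b*n] p M q N ⟩
      (2# ^ p) ^ M * (2# ^ q) ^ N
        ≤⟨ *-mono-≤ (^-nonNeg M (≤-trans (0≤2^ p) 2^v≤a)) (^-nonNeg N (0≤2^ q))
             (^-monoˡ-≤ M (0≤2^ p) 2^v≤a) (^-monoˡ-≤ N (0≤2^ q) 2^w≤b) ⟩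
      (2# ^ r * a ^ N) ^ M * (2# ^ s * b ^ M) ^ N
        ≈⟨ *-cong (^-distrib-* (2# ^ r) (a ^ N) M) (^-distrib-* (2# ^ s) (b ^ M) N) ⟩
      (2# ^ r) ^ M * (a ^ N) ^ M * ((2# ^ s) ^ N * (b ^ M) ^ N)
        ≈⟨ *-cong (*-congˡ (^-assocʳ a N M)) (*-congˡ (Eq.trans (^-exchange b M N) (^-assocʳ b N M))) ⟩
      (2# ^ r) ^ M * a ^ (N ℕ.* M) * ((2# ^ s) ^ N * b ^ (N ℕ.* M))
        ≈⟨ solve 4 (λ r a s b → r :* a :* (s :* b) := r :* s :* (a :* b)) Eq.refl _ _ _ _ ⟩
      (2# ^ r) ^ M * (2# ^ s) ^ N * (a ^ (N ℕ.* M) * b ^ (N ℕ.* M))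
        ≈⟨ *-cong (2^[a*m+b*n] r M s N) (^-distrib-* a b (N ℕ.* M)) ⟨
      2# ^ (r ℕ.* M ℕ.+ s ℕ.* N) * (a * b) ^ (N ℕ.* M) ∎)
    where
    N = suc n
    M = suc m

    v+w≈ : (N ℕ.* M) · (v + w) + (r ℕ.* M ℕ.+ s ℕ.* N) · 1# ≈ (p ℕ.* M ℕ.+ q ℕ.* N) · 1#
    v+w≈ = begin-equality
      (N ℕ.* M) · (v + w) + (r ℕ.* M ℕ.+ s ℕ.* N) · 1#
        ≈⟨ +-cong (×-distrib-+ v w (N ℕ.* M)) ([a*m+b*n]·1 r M s N) ⟩
      (N ℕ.* M) · v + (N ℕ.* M) · w + (M · (r · 1#) + N · (s · 1#))
        ≈⟨ +-congʳ (+-cong (Eq.trans (×-congˡ (ℕₚ.*-comm N M)) (Eq.sym (×-assocˡ v M N)))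
                           (Eq.sym (×-assocˡ w N M))) ⟩
      M · (N · v) + N · (M · w) + (M · (r · 1#) + N · (s · 1#))
        ≈⟨ solve 4 (λ v w r s → v :+ w :+ (r :+ s) := (v :+ r) :+ (w :+ s)) Eq.refl _ _ _ _ ⟩
      (M · (N · v) + M · (r · 1#)) + (N · (M · w) + N · (s · 1#))
        ≈⟨ +-cong (×-distrib-+ (N · v) (r · 1#) M) (×-distrib-+ (M · w) (s · 1#) N) ⟨
      M · (N · v + r · 1#) + N · (M · w + s · 1#)
        ≈⟨ +-cong (×-congʳ M v≈) (×-congʳ N w≈) ⟩
      M · (p · 1#) + N · (q · 1#)
        ≈⟨ [a*m+b*n]·1 p M q N ⟨
      (p ℕ.* M ℕ.+ q ℕ.* N) · 1# ∎

  log₂-mono′ : ∀ {a b} → DyadicBounds a → DyadicBounds b → a ≤ b → log₂ a ≤ log₂ b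
  log₂-mono′ A B a≤b = log₂-least A _ λ w w∈a →
    log₂-upper B w (exponentBelow-mono (nonNeg A) a≤b w∈a)

  -- Exponents below `a` and `b` add up to an exponent below `a * b`. The two suprema are taken one
  -- after the other, the other summand being moved to the right-hand side each time.
  log₂-superadditive : ∀ {a b} → DyadicBounds a → DyadicBounds b →
                       log₂ a + log₂ b ≤ log₂ (a * b)
  log₂-superadditive {a} {b} A B = x≤z-y⇒x+y≤z (log₂-least A _ λ v v∈a →
    x+y≤z⇒x≤z-y (≤-trans (≤-reflexive (+-comm v (log₂ b)))
      (x≤z-y⇒x+y≤z (log₂-least B _ λ w w∈b → x+y≤z⇒x≤z-y
        (≤-trans (≤-reflexive (+-comm w v))
          (log₂-upper (dyadicBounds-* A B) (v + w) (exponentBelow-* v∈a w∈b)))))))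

  -- Rounding N log₂ a and N log₂ b down to integers costs at most 2, which is
  -- negligible as N → ∞.
  log₂-subadditive : ∀ {a b} → DyadicBounds a → DyadicBounds b →
                     log₂ (a * b) ≤ log₂ a + log₂ b
  log₂-subadditive {a} {b} A B = ·-≤-slack⇒≤ {z = 2 · 1#} bound
    where
    bound : ∀ n → suc n · log₂ (a * b) ≤ suc n · (log₂ a + log₂ b) + 2 · 1#
    bound n with dyadicFloor (dyadicBounds-^ (suc n) A) | dyadicFloor (dyadicBounds-^ (suc n) B)
    ... | r , p , 2^p≤ , ≤2^p+1 | s , q , 2^q≤ , ≤2^q+1
      -- `v` and `w` approximate the two logarithms from below; `x` has both integer parts rounded
      -- up instead, so it bounds `log₂ (a * b)` from above and exceeds `v + w` by exactly `2/N`.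
      with fraction n r p | fraction n s q | fraction n (r ℕ.+ s) (suc p ℕ.+ suc q)
    ... | v , v≈ | w , w≈ | x , x≈ = begin
      N · log₂ (a * b)                ≤⟨ ·-monoʳ-≤ N (log₂-least (dyadicBounds-* A B) x
                                          (exponentAbove n (r ℕ.+ s) (suc p ℕ.+ suc q)
                                            (nonNeg (dyadicBounds-* A B)) x≈ product≤)) ⟩
      N · x                           ≤⟨ +-cancelʳ-≤ ((r ℕ.+ s) · 1#) (≤-reflexive N·x≈) ⟩
      N · (v + w) + 2 · 1#            ≤⟨ +-monoˡ-≤ (2 · 1#) (·-monoʳ-≤ N (+-mono-≤
                                          (log₂-upper A v (p , r , n , v≈ , 2^p≤))
                                          (log₂-upper B w (q , s , n , w≈ , 2^q≤)))) ⟩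
      N · (log₂ a + log₂ b) + 2 · 1#  ∎
      where
      N = suc n

      product≤ : 2# ^ (r ℕ.+ s) * (a * b) ^ N ≤ 2# ^ (suc p ℕ.+ suc q)
      product≤ = begin
        2# ^ (r ℕ.+ s) * (a * b) ^ N        ≈⟨ *-cong (^-homo-* 2# r s) (^-distrib-* a b N) ⟩
        2# ^ r * 2# ^ s * (a ^ N * b ^ N)
          ≈⟨ solve 4 (λ r s a b → r :* s :* (a :* b) := (r :* a) :* (s :* b))
               Eq.refl _ _ _ _ ⟩
        (2# ^ r * a ^ N) * (2# ^ s * b ^ N)
          ≤⟨ *-mono-≤ (0≤2^ (suc p)) (≤-trans (0≤2^ q) 2^q≤) ≤2^p+1 ≤2^q+1 ⟩
        2# ^ suc p * 2# ^ suc q             ≈⟨ ^-homo-* 2# (suc p) (suc q) ⟨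
        2# ^ (suc p ℕ.+ suc q)              ∎

      N·x≈ : N · x + (r ℕ.+ s) · 1# ≈ N · (v + w) + 2 · 1# + (r ℕ.+ s) · 1#
      N·x≈ = begin-equality
        N · x + (r ℕ.+ s) · 1#
          ≈⟨ x≈ ⟩
        (suc p ℕ.+ suc q) · 1#
          ≈⟨ ×-homo-+ 1# (suc p) (suc q) ⟩
        suc p · 1# + suc q · 1#
          ≈⟨ +-cong (+-congˡ v≈) (+-congˡ w≈) ⟨
        (1# + (N · v + r · 1#)) + (1# + (N · w + s · 1#))
          ≈⟨ solve 5 (λ e v r w s → (e :+ (v :+ r)) :+ (e :+ (w :+ s)) :=
                                    v :+ w :+ (e :+ (e :+ con 0)) :+ (r :+ s))
               Eq.refl 1# _ _ _ _ ⟩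
        N · v + N · w + 2 · 1# + (r · 1# + s · 1#)
          ≈⟨ +-cong (+-congʳ (×-distrib-+ v w N)) (×-homo-+ 1# r s) ⟨
        N · (v + w) + 2 · 1# + (r ℕ.+ s) · 1# ∎

  -- The order is decidable, so the doubly negated conclusion of `dyadicBounds` can be used whenever
  -- the goal is an inequality.
  ≤-stable : ∀ {x y} → ¬ ¬ (x ≤ y) → x ≤ y
  ≤-stable {x} {y} = decidable-stable (x ≤? y)

  log₂-mono-≤ : ∀ {a b} → 0# < a → 0# < b → a ≤ b → log₂ a ≤ log₂ b
  log₂-mono-≤ 0<a 0<b a≤b = ≤-stable λ ≰ →
    dyadicBounds 0<a λ A → dyadicBounds 0<b λ B → ≰ (log₂-mono′ A B a≤b)

  -- Both halves of the functional equation in one statement, shaped for the comparison of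
  -- `minProb π * V[ π , C₁ ∥ C₂ ]` with `V[ π , C₁ ] * V[ π , C₂ ]`.
  log₂-*-mono-≤ : ∀ {a b c d} → 0# < a → 0# < b → 0# < c → 0# < d →
                  a * b ≤ c * d → log₂ a + log₂ b ≤ log₂ c + log₂ d
  log₂-*-mono-≤ {a} {b} {c} {d} 0<a 0<b 0<c 0<d ab≤cd = ≤-stable λ ≰ →
    dyadicBounds 0<a λ A → dyadicBounds 0<b λ B →
    dyadicBounds 0<c λ C → dyadicBounds 0<d λ D → ≰ (begin
      log₂ a + log₂ b ≤⟨ log₂-superadditive A B ⟩
      log₂ (a * b)    ≤⟨ log₂-mono′ (dyadicBounds-* A B) (dyadicBounds-* C D) ab≤cd ⟩
      log₂ (c * d)    ≤⟨ log₂-subadditive C D ⟩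
      log₂ c + log₂ d ∎)

-- Finite sums and maxima.

module LeakageProperties {ℓ : Level} (ℝ : CompleteOrderedField ℓ) where

  open OrderedFieldProperties ℝ
  open LogarithmProperties ℝ
  open Leakage ℝ
  open FiniteSet
  open Prior
  open Channel
  open import Algebra.Properties.Semiring.Sum semiring
    using (sum; sum-cong-≋; *-distribˡ-sum; *-distribʳ-sum; ∑-comm)
  module Extrema = ListExtrema totalOrder

  enum-surjective : ∀ X (x : Elem X) → ∃[ i ] enum X i ≡.≡ x
  enum-surjective X x = Inverse.from (enumeration X) x , Inverse.strictlyInverseˡ (enumeration X) x

  sum-mono-≤ : ∀ {n} {f g : Fin n → Carrier} → (∀ i → f i ≤ g i) → sum f ≤ sum g
  sum-mono-≤ {zero}  f≤g = ≤-refl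
  sum-mono-≤ {suc n} f≤g = +-mono-≤ (f≤g zero) (sum-mono-≤ (f≤g ∘ suc))

  ∑-mono-≤ : ∀ X {f g : Elem X → Carrier} → (∀ x → f x ≤ g x) → ∑ X f ≤ ∑ X g
  ∑-mono-≤ X f≤g = sum-mono-≤ (f≤g ∘ enum X)

  ∑-cong : ∀ X {f g : Elem X → Carrier} → (∀ x → f x ≈ g x) → ∑ X f ≈ ∑ X g
  ∑-cong X f≈g = sum-cong-≋ (f≈g ∘ enum X)

  *-distribˡ-∑ : ∀ X a (f : Elem X → Carrier) → a * ∑ X f ≈ ∑ X (λ x → a * f x)
  *-distribˡ-∑ X a f = *-distribˡ-sum a (f ∘ enum X)

  *-distribʳ-∑ : ∀ X a (f : Elem X → Carrier) → ∑ X f * a ≈ ∑ X (λ x → f x * a)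
  *-distribʳ-∑ X a f = *-distribʳ-sum a (f ∘ enum X)

  ≤-maximum : ∀ X (f : Elem X → Carrier) x → f x ≤ maximum X f
  ≤-maximum X f x with enum-surjective X x
  ... | i , ≡.refl = All.lookup (Extrema.xs≤max _ _) (∈-tabulate⁺ {f = f ∘ enum X} i)

  maximum-≤ : ∀ X {f : Elem X → Carrier} {u} → (∀ x → f x ≤ u) → maximum X f ≤ u
  maximum-≤ X f≤u = Extrema.max≤v⁺ (f≤u _) (All.tabulate⁺ (f≤u ∘ enum X))

  -- The maximum is one of the values of `f`, so whatever holds of every value holds of it.
  *-maximum-≤ : ∀ X {f : Elem X → Carrier} {a u} →
                (∀ x → a * f x ≤ u) → a * maximum X f ≤ u
  *-maximum-≤ X {f} {a} {u} a*f≤u =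
    Extrema.argmax-all id {P = λ z → a * z ≤ u} (a*f≤u _) (All.tabulate⁺ (a*f≤u ∘ enum X))

  maximum-mono-≤ : ∀ X {f g : Elem X → Carrier} → (∀ x → f x ≤ g x) → maximum X f ≤ maximum X g
  maximum-mono-≤ X {g = g} f≤g = maximum-≤ X λ x → ≤-trans (f≤g x) (≤-maximum X g x)

  -- For each `x` the sum is dominated term by term by the maxima. All lower bounds on
  -- vulnerabilities of channels come from this exchange.
  maximum-∑-≤ : ∀ X Y (f : Elem X → Elem Y → Carrier) →
                maximum X (λ x → ∑ Y (f x)) ≤ ∑ Y (λ y → maximum X (λ x → f x y))
  maximum-∑-≤ X Y f = maximum-≤ X λ x → ∑-mono-≤ Y λ y → ≤-maximum X (λ x → f x y) x

  row-sum : ∀ {X Y} (C : Channel X Y) a x → ∑ Y (λ y → a * entry C x y) ≈ a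
  row-sum {Y = Y} C a x = begin-equality
    ∑ Y (λ y → a * entry C x y) ≈⟨ *-distribˡ-∑ Y a (entry C x) ⟨
    a * ∑ Y (entry C x)         ≈⟨ *-congˡ (total C x) ⟩
    a * 1#                      ≈⟨ *-identityʳ a ⟩
    a                           ∎

  -- Positivity of vulnerabilities and of the least nonzero probability.

  module _ {X : FiniteSet} (π : Prior X) where

    -- Were the largest probability zero, all would be at most zero and could not sum to `1#`.
    0<V : 0# < V π
    0<V = ≤-trans (nonNeg π (enum X zero)) (≤-maximum X (prob π) _) , λ 0≈V →
      <⇒≱ 0<1 (begin
        1#                ≈⟨ total π ⟨
        ∑ X (prob π)      ≤⟨ ∑-mono-≤ X (λ x →
                               ≤-trans (≤-maximum X (prob π) x) (≤-reflexive (Eq.sym 0≈V))) ⟩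
        ∑ X (λ _ → 0#)    ≈⟨ sum-zero (suc (size-1 X)) ⟩
        0#                ∎)
      where
      sum-zero : ∀ n → sum {n} (λ _ → 0#) ≈ 0#
      sum-zero zero    = Eq.refl
      sum-zero (suc n) = Eq.trans (+-identityˡ _) (sum-zero n)

    probs : List Carrier
    probs = tabulate (prob π ∘ enum X)

    -- The seed `V π` is positive, and so is every probability kept by the filter, being nonnegative
    -- and nonzero.
    0<minProb : 0# < minProb π
    0<minProb = Extrema.v<min⁺ 0<V
      (All.zipWith (λ (0≤p , p≉0) → 0≤p , p≉0 ∘ Eq.sym)
        ( All.filter⁺ (λ p → ¬? (p ≟ 0#)) (All.tabulate⁺ {f = prob π ∘ enum X} (nonNeg π ∘ enum X))
        , All.all-filter (λ p → ¬? (p ≟ 0#)) probs))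

    minProb-≤ : ∀ x → ¬ (prob π x ≈ 0#) → minProb π ≤ prob π x
    minProb-≤ x p≉0 with enum-surjective X x
    ... | i , ≡.refl = All.lookup (Extrema.min≤xs (V π) _)
      (∈-filter⁺ (λ p → ¬? (p ≟ 0#)) (∈-tabulate⁺ {f = prob π ∘ enum X} i) p≉0)

    -- Off the support both sides vanish; on it `minProb-≤` is multiplied by `prob π x`. The square
    -- provides one copy of the prior for each of the two channels.
    minProb*prob≤prob*prob : ∀ x → minProb π * prob π x ≤ prob π x * prob π x
    minProb*prob≤prob*prob x with prob π x ≟ 0#
    ... | yes p≈0 = ≤-reflexive (Eq.trans (zeroed (minProb π)) (Eq.sym (zeroed (prob π x))))
      where
      zeroed : ∀ a → a * prob π x ≈ 0#
      zeroed a = Eq.trans (*-congˡ p≈0) (zeroʳ a)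
    ... | no p≉0  = *-monoˡ-≤ (nonNeg π x) (minProb-≤ x p≉0)

    -- Each `prob π x` is spread over the outputs, as the rows of `C` sum to `1#`; then the maximum
    -- moves inside the sum. Positivity of `V[ π , C ]` follows.
    V≤V[_] : ∀ {Y} (C : Channel X Y) → V π ≤ V[ π , C ]
    V≤V[_] {Y} C = ≤-trans
      (maximum-mono-≤ X λ x → ≤-reflexive (Eq.sym (row-sum C (prob π x) x)))
      (maximum-∑-≤ X Y λ x y → prob π x * entry C x y)

    0<V[_] : ∀ {Y} (C : Channel X Y) → 0# < V[ π , C ]
    0<V[ C ] = ≤-trans (proj₁ 0<V) (V≤V[ C ]) , λ 0≈ →
      <⇒≱ 0<V (≤-trans (V≤V[ C ]) (≤-reflexive (Eq.sym 0≈)))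

    -- Parallel composition of two channels.

    module _ {Y₁ Y₂ : FiniteSet} (C₁ : Channel X Y₁) (C₂ : Channel X Y₂) where

      joint : Elem X → Elem Y₁ → Elem Y₂ → Carrier
      joint x y₁ y₂ = prob π x * (entry C₁ x y₁ * entry C₂ x y₂)

      max∥ : Elem Y₁ → Elem Y₂ → Carrier
      max∥ y₁ y₂ = maximum X (λ x → joint x y₁ y₂)

      V-∥ : V[ π , C₁ ∥ C₂ ] ≈ ∑ Y₁ (λ y₁ → ∑ Y₂ (max∥ y₁))
      V-∥ = ∑-× Y₁ Y₂ (λ (y₁ , y₂) → max∥ y₁ y₂)

      -- Since the rows of `C₂` sum to `1#`, the product of the prior and `C₁` is a marginal of
      -- `joint`.
      V₁≤V-∥ : V[ π , C₁ ] ≤ V[ π , C₁ ∥ C₂ ]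
      V₁≤V-∥ = begin
        ∑ Y₁ (λ y₁ → maximum X (λ x → prob π x * entry C₁ x y₁))
          ≤⟨ ∑-mono-≤ Y₁ (λ y₁ → maximum-mono-≤ X λ x → ≤-reflexive (marginal x y₁)) ⟩
        ∑ Y₁ (λ y₁ → maximum X (λ x → ∑ Y₂ (joint x y₁)))
          ≤⟨ ∑-mono-≤ Y₁ (λ y₁ → maximum-∑-≤ X Y₂ (λ x → joint x y₁)) ⟩
        ∑ Y₁ (λ y₁ → ∑ Y₂ (max∥ y₁))
          ≈⟨ V-∥ ⟨
        V[ π , C₁ ∥ C₂ ] ∎
        where
        marginal : ∀ x y₁ → prob π x * entry C₁ x y₁ ≈ ∑ Y₂ (joint x y₁)
        marginal x y₁ = Eq.trans (Eq.sym (row-sum C₂ _ x))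
          (∑-cong Y₂ λ y₂ → *-assoc (prob π x) (entry C₁ x y₁) (entry C₂ x y₂))

      V₂≤V-∥ : V[ π , C₂ ] ≤ V[ π , C₁ ∥ C₂ ]
      V₂≤V-∥ = begin
        ∑ Y₂ (λ y₂ → maximum X (λ x → prob π x * entry C₂ x y₂))
          ≤⟨ ∑-mono-≤ Y₂ (λ y₂ → maximum-mono-≤ X λ x → ≤-reflexive (marginal x y₂)) ⟩
        ∑ Y₂ (λ y₂ → maximum X (λ x → ∑ Y₁ (λ y₁ → joint x y₁ y₂)))
          ≤⟨ ∑-mono-≤ Y₂ (λ y₂ → maximum-∑-≤ X Y₁ (λ x y₁ → joint x y₁ y₂)) ⟩
        ∑ Y₂ (λ y₂ → ∑ Y₁ (λ y₁ → max∥ y₁ y₂))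
          ≈⟨ ∑-comm (λ j i → max∥ (enum Y₁ i) (enum Y₂ j)) ⟩
        ∑ Y₁ (λ y₁ → ∑ Y₂ (max∥ y₁))
          ≈⟨ V-∥ ⟨
        V[ π , C₁ ∥ C₂ ] ∎
        where
        marginal : ∀ x y₂ → prob π x * entry C₂ x y₂ ≈ ∑ Y₁ (λ y₁ → joint x y₁ y₂)
        marginal x y₂ = Eq.trans (Eq.sym (row-sum C₁ _ x)) (∑-cong Y₁ λ y₁ →
          solve 3 (λ p c d → p :* d :* c := p :* (c :* d)) Eq.refl
            (prob π x) (entry C₁ x y₁) (entry C₂ x y₂))

      -- At each pair of outputs the bound is a product of a factor in `y₁` and a factor in `y₂`, so
      -- the double sum splits into the two vulnerabilities.
      minProb*V-∥≤V₁*V₂ : minProb π * V[ π , C₁ ∥ C₂ ] ≤ V[ π , C₁ ] * V[ π , C₂ ]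
      minProb*V-∥≤V₁*V₂ = begin
        m * V[ π , C₁ ∥ C₂ ]
          ≈⟨ *-congˡ V-∥ ⟩
        m * ∑ Y₁ (λ y₁ → ∑ Y₂ (max∥ y₁))
          ≈⟨ *-distribˡ-∑ Y₁ m (λ y₁ → ∑ Y₂ (max∥ y₁)) ⟩
        ∑ Y₁ (λ y₁ → m * ∑ Y₂ (max∥ y₁))
          ≈⟨ ∑-cong Y₁ (λ y₁ → *-distribˡ-∑ Y₂ m (max∥ y₁)) ⟩
        ∑ Y₁ (λ y₁ → ∑ Y₂ (λ y₂ → m * maximum X (λ x → joint x y₁ y₂)))
          ≤⟨ ∑-mono-≤ Y₁ (λ y₁ → ∑-mono-≤ Y₂ λ y₂ → *-maximum-≤ X (pointwise y₁ y₂)) ⟩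
        ∑ Y₁ (λ y₁ → ∑ Y₂ (λ y₂ → max₁ y₁ * max₂ y₂))
          ≈⟨ ∑-cong Y₁ (λ y₁ → *-distribˡ-∑ Y₂ (max₁ y₁) max₂) ⟨
        ∑ Y₁ (λ y₁ → max₁ y₁ * V[ π , C₂ ])
          ≈⟨ *-distribʳ-∑ Y₁ V[ π , C₂ ] max₁ ⟨
        V[ π , C₁ ] * V[ π , C₂ ] ∎
        where
        m : Carrier
        m = minProb π

        max₁ : Elem Y₁ → Carrier
        max₁ y₁ = maximum X (λ x → prob π x * entry C₁ x y₁)

        max₂ : Elem Y₂ → Carrier
        max₂ y₂ = maximum X (λ x → prob π x * entry C₂ x y₂)

        pointwise : ∀ y₁ y₂ x → m * joint x y₁ y₂ ≤ max₁ y₁ * max₂ y₂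
        pointwise y₁ y₂ x = begin
          m * (p * (c * d))     ≈⟨ *-assoc m p (c * d) ⟨
          m * p * (c * d)       ≤⟨ *-monoˡ-≤ (*-nonNeg (nonNeg C₁ x y₁) (nonNeg C₂ x y₂))
                                     (minProb*prob≤prob*prob x) ⟩
          p * p * (c * d)       ≈⟨ solve 3 (λ p c d → p :* p :* (c :* d) := (p :* c) :* (p :* d))
                                     Eq.refl p c d ⟩
          (p * c) * (p * d)     ≤⟨ *-mono-≤ (≤-trans 0≤pc pc≤) (*-nonNeg (nonNeg π x) (nonNeg C₂ x y₂))
                                     pc≤ (≤-maximum X (λ x → prob π x * entry C₂ x y₂) x) ⟩
          max₁ y₁ * max₂ y₂     ∎
          where
          p = prob π x
          c = entry C₁ x y₁
          d = entry C₂ x y₂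

          0≤pc : 0# ≤ p * c
          0≤pc = *-nonNeg (nonNeg π x) (nonNeg C₁ x y₁)

          pc≤ : p * c ≤ max₁ y₁
          pc≤ = ≤-maximum X (λ x → prob π x * entry C₁ x y₁) x

      H∥≤H₁ : H∞[ π , C₁ ∥ C₂ ] ≤ H∞[ π , C₁ ]
      H∥≤H₁ = neg-anti-≤ (log₂-mono-≤ 0<V[ C₁ ] 0<V[ C₁ ∥ C₂ ] V₁≤V-∥)

      H∥≤H₂ : H∞[ π , C₁ ∥ C₂ ] ≤ H∞[ π , C₂ ]
      H∥≤H₂ = neg-anti-≤ (log₂-mono-≤ 0<V[ C₂ ] 0<V[ C₁ ∥ C₂ ] V₂≤V-∥)

      H₁+H₂-Hᵐⁱⁿ≤H∥ : H∞[ π , C₁ ] + H∞[ π , C₂ ] - Hᵐⁱⁿ π ≤ H∞[ π , C₁ ∥ C₂ ]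
      -- With `Hᵐⁱⁿ π` moved to the right, each side is the negative of a sum of two logarithms.
      H₁+H₂-Hᵐⁱⁿ≤H∥ = x≤z+y⇒x-y≤z (begin
        H∞[ π , C₁ ] + H∞[ π , C₂ ]               ≈⟨ -‿+-comm _ _ ⟩
        - (log₂ V[ π , C₁ ] + log₂ V[ π , C₂ ])   ≤⟨ neg-anti-≤ (log₂-*-mono-≤ 0<minProb
                                                      0<V[ C₁ ∥ C₂ ] 0<V[ C₁ ] 0<V[ C₂ ] minProb*V-∥≤V₁*V₂) ⟩
        - (log₂ (minProb π) + log₂ V[ π , C₁ ∥ C₂ ]) ≈⟨ -‿+-comm _ _ ⟨
        Hᵐⁱⁿ π + H∞[ π , C₁ ∥ C₂ ]                ≈⟨ +-comm _ _ ⟩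
        H∞[ π , C₁ ∥ C₂ ] + Hᵐⁱⁿ π                ∎)

      I∥≤I₁+I₂+Hᵐⁱⁿ-H : I∞[ π , C₁ ∥ C₂ ] ≤ I∞[ π , C₁ ] + I∞[ π , C₂ ] + Hᵐⁱⁿ π - H∞ π
      I∥≤I₁+I₂+Hᵐⁱⁿ-H = begin
        h - H∞[ π , C₁ ∥ C₂ ]     ≤⟨ +-monoʳ-≤ h (neg-anti-≤ H₁+H₂-Hᵐⁱⁿ≤H∥) ⟩
        h - (h₁ + h₂ - k)         ≈⟨ +-congˡ (-‿anti-homo-- (h₁ + h₂) k) ⟩
        h + (k - (h₁ + h₂))       ≈⟨ +-congˡ (+-congˡ (-‿+-comm h₁ h₂)) ⟨
        -- The target contains `h` twice and subtracts it once, so `h` is added and subtracted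
        -- before regrouping.
        h + (k + (- h₁ - h₂))     ≈⟨ x+y-y≈x _ h ⟨
        h + (k + (- h₁ - h₂)) + h - h
          ≈⟨ +-congʳ (solve 4 (λ h k a b → h :+ (k :+ (a :+ b)) :+ h := h :+ a :+ (h :+ b) :+ k)
               Eq.refl h k (- h₁) (- h₂)) ⟩
        (h - h₁) + (h - h₂) + k - h ∎
        where
        h  = H∞ π
        h₁ = H∞[ π , C₁ ]
        h₂ = H∞[ π , C₂ ]
        k  = Hᵐⁱⁿ π

corollary4p4 : ∀ {ℓ : Level} (ℝ : CompleteOrderedField ℓ) →
    let open CompleteOrderedField ℝ
        open Leakage ℝ in
    ∀ {X Y₁ Y₂ : FiniteSet} (π : Prior X) (C₁ : Channel X Y₁) (C₂ : Channel X Y₂) →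
      (H∞[ π , C₁ ∥ C₂ ] ≥ H∞[ π , C₁ ] + H∞[ π , C₂ ] - Hᵐⁱⁿ π)
      × (H∞[ π , C₁ ∥ C₂ ] ≤ H∞[ π , C₁ ] ⊓ H∞[ π , C₂ ])
      × (I∞[ π , C₁ ∥ C₂ ] ≥ I∞[ π , C₁ ] ⊔ I∞[ π , C₂ ])
      × (I∞[ π , C₁ ∥ C₂ ] ≤ I∞[ π , C₁ ] + I∞[ π , C₂ ] + Hᵐⁱⁿ π - H∞ π)
corollary4p4 ℝ π C₁ C₂ =
    H₁+H₂-Hᵐⁱⁿ≤H∥ π C₁ C₂
  , ⊓-glb (H∥≤H₁ π C₁ C₂) (H∥≤H₂ π C₁ C₂)
  -- Each leakage subtracts an entropy from the same `H∞ π`, so the two bounds behind (2) are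
  -- reversed.
  , ⊔-lub (+-monoʳ-≤ _ (neg-anti-≤ (H∥≤H₁ π C₁ C₂))) (+-monoʳ-≤ _ (neg-anti-≤ (H∥≤H₂ π C₁ C₂)))
  , I∥≤I₁+I₂+Hᵐⁱⁿ-H π C₁ C₂
  where
  open OrderedFieldProperties ℝ
  open LeakageProperties ℝ
  open import Algebra.Construct.NaturalChoice.Min totalOrder using (⊓-glb)
  open import Algebra.Construct.NaturalChoice.Max totalOrder using (⊔-lub)
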